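{- Let $k>0$ be an even integer. Let $f=\sum_{n>0}a_n(f)q^n\in S_k(SL_2(\mathbb{Z}))$ be a newform of weight $k$ and level $1$ with $a_n(f)\in\mathbb{Z}$ for all $n$. Suppose $|a_2(f)|\neq 2^{k/2}$ and $|a_3(f)|\neq 3^{k/2}$. Then the smallest $n\ge 1$ for which $a_n(f)=0$ is a prime; that is, if the set $\{n\ge 1: a_n(f)=0\}$ is nonempty, then its least element is a prime number.
   Context: Here $q=e^{2\pi i z}$, $S_k(SL_2(\mathbb{Z}))$ is the space of cusp forms of weight $k$ for $SL_2(\mathbb{Z})$ (level $1$), and a newform of level $1$ is a Hecke eigenform in this space normalized so that $a_1(f)=1$. -}

module Defs where

open import Data.Integer.Base as ℤ using (ℤ; +_; -1ℤ; 1ℤ)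
open import Data.Nat.Base as ℕ using (ℕ; zero; suc; _!)
open import Data.Nat.Divisibility using (_∣_; divides; _∣?_)
open import Data.Nat.Primality using (Prime)
open import Data.Nat.Properties using (_!≢0)
open import Data.Product.Base using (Σ; _×_; ∃-syntax)
open import Data.Rational.Base as ℚ using (ℚ; 0ℚ; 1ℚ)
open import Relation.Binary.PropositionalEquality.Core using (_≡_)
open import Relation.Nullary.Decidable.Core using (yes; no)

record ℚ[i] : Set where
  constructor _+i_
  field
    re im : ℚ

open ℚ[i] public

-- Real and complex numbers are Cauchy sequences of (Gaussian) rationals,
-- considered up to the equivalence _≈_ below.  The operations act termwise on
-- arbitrary sequences; they preserve Cauchy sequences and compute the usual
-- operations on their limits.

Seqℝ Seqℂ : Set
Seqℝ = ℕ → ℚ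
Seqℂ = ℕ → ℚ[i]

constℝ : ℚ → Seqℝ
constℝ r _ = r

constℂ : ℚ[i] → Seqℂ
constℂ z _ = z

infix 4 _≤ᵣ_ _≈_
infixl 6 _+_ _-_
infixl 7 _*_ _*ᵣ_
infixr 8 _^_

-- Inequality of the limits, hence the slack η.
_≤ᵣ_ : Seqℝ → Seqℝ → Set
x ≤ᵣ y = ∀ (η : ℚ) → 0ℚ ℚ.< η → ∃[ N ] ∀ m → N ℕ.≤ m → x m ℚ.≤ y m ℚ.+ η

_*ᵣ_ : Seqℝ → Seqℝ → Seqℝ
(x *ᵣ y) m = x m ℚ.* y m

_+_ _-_ _*_ : Seqℂ → Seqℂ → Seqℂ
(x + y) m = (re (x m) ℚ.+ re (y m)) +i (im (x m) ℚ.+ im (y m))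
(x - y) m = (re (x m) ℚ.- re (y m)) +i (im (x m) ℚ.- im (y m))
(x * y) m = (re (x m) ℚ.* re (y m) ℚ.- im (x m) ℚ.* im (y m))
         +i (re (x m) ℚ.* im (y m) ℚ.+ im (x m) ℚ.* re (y m))

-- The norm |re| + |im|, which is equivalent to the usual absolute value
-- and takes rational values on ℚ[i].
‖_‖ : ℚ[i] → ℚ
‖ x +i y ‖ = ℚ.∣ x ∣ ℚ.+ ℚ.∣ y ∣

norm : Seqℂ → Seqℝ
norm x m = ‖ x m ‖

_≈_ : Seqℂ → Seqℂ → Set
x ≈ y = norm (x - y) ≤ᵣ constℝ 0ℚ

fromℚ : ℚ → Seqℂ
fromℚ r = constℂ (r +i 0ℚ)

fromℤ : ℤ → Seqℂ
fromℤ n = fromℚ (n ℚ./ 1)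

fromℕ : ℕ → Seqℂ
fromℕ n = fromℤ (+ n)

_^_ : Seqℂ → ℕ → Seqℂ
x ^ zero  = fromℕ 1
x ^ suc n = x * x ^ n

-- ∑ n t = t 0 + t 1 + ⋯ + t n
∑ : ℕ → (ℕ → Seqℂ) → Seqℂ
∑ zero    t = t zero
∑ (suc n) t = ∑ n t + t (suc n)

IsCauchy : Seqℂ → Set
IsCauchy x = ∀ (ε : ℚ) → 0ℚ ℚ.< ε →
  ∃[ N ] ∀ m n → N ℕ.≤ m → N ℕ.≤ n → norm (x - constℂ (x n)) m ℚ.≤ ε

record ℂ : Set where
  field
    approx : Seqℂ
    cauchy : IsCauchy approx

open ℂ public

ConvergesTo : (ℕ → Seqℂ) → Seqℂ → Set
ConvergesTo s l = ∀ (ε : ℚ) → 0ℚ ℚ.< ε →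
  ∃[ N ] ∀ n → N ℕ.≤ n → norm (s n - l) ≤ᵣ constℝ ε

-- The m-th approximation is ∑_{j ≤ m} (w m)ʲ / j!.  A Cauchy sequence w is
-- bounded, so the tails of these series are uniformly small and the limit is
-- the exponential of the limit of w.
exp : Seqℂ → Seqℂ
exp w m = ∑ m (λ j → fromℚ (ℚ._/_ 1ℤ (j !) {{j !≢0}}) * w ^ j) m

-- Leibniz's series: the m-th approximation is ∑_{j ≤ m} 4 (-1)ʲ / (2j + 1).
π : Seqℂ
π m = ∑ m (λ j → fromℚ ((+ 4 ℤ.* -1ℤ ℤ.^ j) ℚ./ suc (2 ℕ.* j))) m

𝑖 : Seqℂ
𝑖 = constℂ (0ℚ +i 1ℚ)

-- The upper half plane.
record ℍ : Set where
  field
    point : ℂ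
    im>0  : ∃[ ε ] 0ℚ ℚ.< ε × constℝ ε ≤ᵣ (λ m → im (approx point m))

⟦_⟧ : ℍ → Seqℂ
⟦ z ⟧ = approx (ℍ.point z)

𝑞 : ℍ → Seqℂ
𝑞 z = exp (fromℕ 2 * π * 𝑖 * ⟦ z ⟧)

record SL₂ℤ : Set where
  field
    a b c d : ℤ
    det≡1   : a ℤ.* d ℤ.- b ℤ.* c ≡ 1ℤ

Holomorphic : (ℍ → ℂ) → Set
Holomorphic f = ∀ z → Σ ℂ λ f′z → ∀ (ε : ℚ) → 0ℚ ℚ.< ε →
  ∃[ δ ] 0ℚ ℚ.< δ × (∀ w → norm (⟦ w ⟧ - ⟦ z ⟧) ≤ᵣ constℝ δ →
    norm (approx (f w) - approx (f z) - approx f′z * (⟦ w ⟧ - ⟦ z ⟧))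
      ≤ᵣ constℝ ε *ᵣ norm (⟦ w ⟧ - ⟦ z ⟧))

-- f (γ z) = (c z + d)ᵏ f z, where w = γ z is expressed as (c z + d) w = a z + b.
WeaklyModular : ℕ → (ℍ → ℂ) → Set
WeaklyModular k f = ∀ (γ : SL₂ℤ) (z w : ℍ) → let open SL₂ℤ γ in
  (fromℤ c * ⟦ z ⟧ + fromℤ d) * ⟦ w ⟧ ≈ fromℤ a * ⟦ z ⟧ + fromℤ b →
  approx (f w) ≈ (fromℤ c * ⟦ z ⟧ + fromℤ d) ^ k * approx (f z)

-- Modular forms for SL₂(ℤ); holomorphy at the cusp is the existence of a
-- q-expansion without negative powers of q.
record ModularForm (k : ℕ) : Set where
  field
    fun          : ℍ → ℂ
    fun-cong     : ∀ z w → ⟦ z ⟧ ≈ ⟦ w ⟧ → approx (fun z) ≈ approx (fun w)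
    holomorphic  : Holomorphic fun
    modular      : WeaklyModular k fun
    coeff        : ℕ → ℂ
    q-expansion  : ∀ z → ConvergesTo (λ N → ∑ N (λ n → approx (coeff n) * 𝑞 z ^ n))
                                     (approx (fun z))

record CuspForm (k : ℕ) : Set where
  field
    modularForm : ModularForm k
  open ModularForm modularForm public
  field
    vanishes-at-∞ : approx (coeff 0) ≈ fromℕ 0

-- The coefficient at n / p, read as 0 when p does not divide n.
coeffAtQuotient : (ℕ → Seqℂ) → ℕ → ℕ → Seqℂ
coeffAtQuotient a n p with p ∣? n
... | yes (divides m _) = a m
... | no  _             = fromℕ 0

-- The weight k Hecke operator T_p, p prime, on q-expansions:
-- aₙ(T_p f) = a_{pn}(f) + p^{k-1} a_{n/p}(f).  Only used for k > 0.
hecke : (k p : ℕ) → (ℕ → Seqℂ) → (ℕ → Seqℂ)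
hecke k p a n = a (p ℕ.* n) + fromℕ p ^ (k ℕ.∸ 1) * coeffAtQuotient a n p

-- The T_p with p prime generate the Hecke algebra in level 1.
HeckeEigenform : ∀ {k} → CuspForm k → Set
HeckeEigenform {k} f = ∀ p → Prime p → Σ ℂ λ eigenvalue →
  ∀ n → hecke k p a n ≈ approx eigenvalue * a n
  where
  a : ℕ → Seqℂ
  a n = approx (CuspForm.coeff f n)

record Newform (k : ℕ) : Set where
  field
    cuspForm : CuspForm k
  open CuspForm cuspForm public
  field
    eigenform  : HeckeEigenform cuspForm
    normalized : approx (coeff 1) ≈ fromℕ 1

IsLeast : (ℕ → Set) → ℕ → Set
IsLeast P n = P n × (∀ m → P m → n ℕ.≤ m)

{-# OPTIONS --safe #-}
-- Let n be the least zero of a, p a prime factor of n, and n = pʳ m with p ∤ m.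
-- The Hecke relations give a(pʳ m) = uᵣ a(m), where u is the Lucas sequence with
-- u₀ = 1, u₁ = a(p), uᵣ₊₂ = a(p) uᵣ₊₁ - P uᵣ and P = pᵏ⁻¹ is an odd power of p.
-- Minimality of n forces uᵣ = 0, and if a(p) = 0 then n = p.  Otherwise, since u
-- is modulo p the sequence of powers of a(p), uᵣ = 0 implies p ∣ a(p); dividing
-- a(p) by p and P by p² repeatedly reduces to P = p.  There a(p) = p b, and
-- p b² < 4 because the sequence has no zeros when a(p)² ≥ 4P > 0.  Hence |b| = 1
-- and p is 2 or 3, so |a(p)| = p^(k/2) for the original a(p), which is excluded.
module Submission where

open import Defs
open import Data.Nat.Base as ℕ using (ℕ; zero; suc; _>_; _≥_; _/_; NonZero; z≤n; s≤s) renaming (_^_ to _^ℕ_)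
open import Data.Nat.Divisibility as ℕ using (_∣_; divides; m∣m*n; ∣⇒≤; _∣?_; ∣1⇒≡1)
open import Data.Nat.DivMod using (m*n/n≡m)
open import Data.Nat.Induction using (<-rec)
open import Data.Nat.Primality using (Prime; euclidsLemma; prime⇒nonZero; prime⇒nonTrivial)
open import Data.Nat.Primality.Factorisation using (factorise)
import Data.Nat.Properties as ℕ
import Data.Nat.Tactic.RingSolver as ℕ-Solver
open import Data.Integer.Base as ℤ using (ℤ; ∣_∣; 0ℤ; 1ℤ; +_)
open import Data.Integer.Divisibility.Signed as ℤ using (∣ᵤ⇒∣; ∣⇒∣ᵤ; ∣m+n∣n⇒∣m; ∣m⇒∣m*n; ∣m⇒∣-m)
import Data.Integer.Properties as ℤ
import Data.Integer.Tactic.RingSolver as ℤ-Solver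
open import Data.List.Base using ([]; _∷_)
open import Data.List.Relation.Unary.All using (_∷_)
open import Data.Product.Base using (_×_; _,_; ∃-syntax; proj₁; proj₂)
open import Data.Rational.Base as ℚ using (ℚ; 0ℚ; 1ℚ; ½; toℚᵘ; Positive)
import Data.Rational.Properties as ℚ
open import Data.Rational.Solver using (module +-*-Solver)
open import Data.Rational.Unnormalised.Base as ℚᵘ using (mkℚᵘ; *≡*)
import Data.Rational.Unnormalised.Properties as ℚᵘ
open import Data.Sum.Base using (_⊎_; inj₁; inj₂; [_,_]′)
open import Function.Base using (_∘_; id)
open import Relation.Binary.Bundles using (Setoid)
import Relation.Binary.Reasoning.Setoid as ≈-Reasoning
open import Relation.Nullary.Decidable using (yes; no; _×-dec_)
open import Relation.Nullary.Negation using (¬_; contradiction)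
open import Relation.Unary using (Decidable)
open import Relation.Binary.PropositionalEquality using (_≡_; _≢_; refl; sym; trans; cong; cong₂; subst; module ≡-Reasoning)

-- Zeros of Lucas sequences

-- With α and β the roots of X² - aX + P, the term at `r` is the sum of αⁱ βʲ over i + j = r. The
-- index is one lower than in the usual Lucas sequence U, which has U₀ = 0 and U₁ = 1.
lucas : ℤ → ℤ → ℕ → ℤ
lucas a P zero          = 1ℤ
lucas a P (suc zero)    = a
lucas a P (suc (suc r)) = a ℤ.* lucas a P (suc r) ℤ.- P ℤ.* lucas a P r

-- Replacing `a` by c a and `P` by c² P multiplies both roots of X² - aX + P by `c`, and the term at
-- `r` is homogeneous of degree `r` in the roots.
lucas-scale : ∀ c a P r → lucas (c ℤ.* a) (c ℤ.* (c ℤ.* P)) r ≡ c ℤ.^ r ℤ.* lucas a P r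
lucas-scale c a P zero          = refl
lucas-scale c a P (suc zero)    = cong (ℤ._* a) (sym (ℤ.*-identityʳ c))
lucas-scale c a P (suc (suc r)) =
  trans (cong₂ (λ x y → c ℤ.* a ℤ.* x ℤ.- c ℤ.* (c ℤ.* P) ℤ.* y)
               (lucas-scale c a P (suc r)) (lucas-scale c a P r))
        (rearrange c a P (c ℤ.^ r) (lucas a P (suc r)) (lucas a P r))
  where
  rearrange : ∀ c a P d x y → c ℤ.* a ℤ.* (c ℤ.* d ℤ.* x) ℤ.- c ℤ.* (c ℤ.* P) ℤ.* (d ℤ.* y)
            ≡ c ℤ.* (c ℤ.* d) ℤ.* (a ℤ.* x ℤ.- P ℤ.* y)
  rearrange = ℤ-Solver.solve-∀

euclidsLemmaℤ : ∀ i j {p} → Prime p → + p ℤ.∣ i ℤ.* j → + p ℤ.∣ i ⊎ + p ℤ.∣ j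
euclidsLemmaℤ i j {p} p-prime p∣ij
  with euclidsLemma (∣ i ∣) (∣ j ∣) p-prime (subst (p ℕ.∣_) (ℤ.∣i*j∣≡∣i∣*∣j∣ i j) (∣⇒∣ᵤ p∣ij))
... | inj₁ p∣i = inj₁ (∣ᵤ⇒∣ p∣i)
... | inj₂ p∣j = inj₂ (∣ᵤ⇒∣ p∣j)

-- Modulo `p` the recurrence loses its `P` term, so each term is `a` times the previous one.
-- Euclid's lemma then descends to the term at 1, which is `a`; the term at 0 is 1, hence the index
-- `suc r`.
prime∣lucas⇒∣ : ∀ {p} a P r → Prime p → + p ℤ.∣ P → + p ℤ.∣ lucas a P (suc r) → + p ℤ.∣ a
prime∣lucas⇒∣ a P zero    _       _   p∣u = p∣u
prime∣lucas⇒∣ a P (suc r) p-prime p∣P p∣u =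
  [ id , prime∣lucas⇒∣ a P r p-prime p∣P ]′
    (euclidsLemmaℤ a (lucas a P (suc r)) p-prime
      (∣m+n∣n⇒∣m p∣u (∣m⇒∣-m (∣m⇒∣m*n (lucas a P r) p∣P))))

∣i∣≤∣i-j∣+∣j∣ : ∀ i j → ∣ i ∣ ℕ.≤ ∣ i ℤ.- j ∣ ℕ.+ ∣ j ∣
∣i∣≤∣i-j∣+∣j∣ i j = subst (λ x → ∣ x ∣ ℕ.≤ ∣ i ℤ.- j ∣ ℕ.+ ∣ j ∣) (cancel i j) (ℤ.∣i+j∣≤∣i∣+∣j∣ (i ℤ.- j) j)
  where
  cancel : ∀ i j → i ℤ.- j ℤ.+ j ≡ i
  cancel = ℤ-Solver.solve-∀

-- Here `v`, `u`, `w` stand for the absolute values of three consecutive terms. After doubling and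
-- adding 4pv on both sides, the claim is the chain 2au + 4pv ≤ 2au + a²v ≤ 4au ≤ 4w + 4pv.
growth-step : ∀ a p u v w → 4 ℕ.* p ℕ.≤ a ℕ.* a → a ℕ.* v ℕ.≤ 2 ℕ.* u →
  a ℕ.* u ℕ.≤ w ℕ.+ p ℕ.* v → a ℕ.* u ℕ.≤ 2 ℕ.* w
growth-step a p u v w 4p≤a² av≤2u au≤w+pv = ℕ.*-cancelˡ-≤ 2 (ℕ.+-cancelʳ-≤ (4 ℕ.* p ℕ.* v) _ _ (begin
  2 ℕ.* (a ℕ.* u) ℕ.+ 4 ℕ.* p ℕ.* v      ≤⟨ ℕ.+-monoʳ-≤ (2 ℕ.* (a ℕ.* u)) (ℕ.*-monoˡ-≤ v 4p≤a²) ⟩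
  2 ℕ.* (a ℕ.* u) ℕ.+ a ℕ.* a ℕ.* v      ≡⟨ cong (2 ℕ.* (a ℕ.* u) ℕ.+_) (ℕ.*-assoc a a v) ⟩
  2 ℕ.* (a ℕ.* u) ℕ.+ a ℕ.* (a ℕ.* v)    ≤⟨ ℕ.+-monoʳ-≤ (2 ℕ.* (a ℕ.* u)) (ℕ.*-monoʳ-≤ a av≤2u) ⟩
  2 ℕ.* (a ℕ.* u) ℕ.+ a ℕ.* (2 ℕ.* u)    ≡⟨ double a u ⟩
  4 ℕ.* (a ℕ.* u)                        ≤⟨ ℕ.*-monoʳ-≤ 4 au≤w+pv ⟩
  4 ℕ.* (w ℕ.+ p ℕ.* v)                  ≡⟨ expand w p v ⟩
  2 ℕ.* (2 ℕ.* w) ℕ.+ 4 ℕ.* p ℕ.* v      ∎))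
  where
  open ℕ.≤-Reasoning
  double : ∀ a u → 2 ℕ.* (a ℕ.* u) ℕ.+ a ℕ.* (2 ℕ.* u) ≡ 4 ℕ.* (a ℕ.* u)
  double = ℕ-Solver.solve-∀
  expand : ∀ w p v → 4 ℕ.* (w ℕ.+ p ℕ.* v) ≡ 2 ℕ.* (2 ℕ.* w) ℕ.+ 4 ℕ.* p ℕ.* v
  expand = ℕ-Solver.solve-∀

-- A nonnegative discriminant a² - 4P makes the sequence grow at least by the factor |a|/2.
lucas-growth : ∀ a P → 4 ℕ.* ∣ P ∣ ℕ.≤ ∣ a ∣ ℕ.* ∣ a ∣ → ∀ r →
  ∣ a ∣ ℕ.* ∣ lucas a P r ∣ ℕ.≤ 2 ℕ.* ∣ lucas a P (suc r) ∣
lucas-growth a P 4P≤a² zero    =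
  ℕ.≤-trans (ℕ.≤-reflexive (ℕ.*-identityʳ ∣ a ∣)) (ℕ.m≤m+n ∣ a ∣ _)
lucas-growth a P 4P≤a² (suc r) =
  growth-step (∣ a ∣) (∣ P ∣) (∣ u ∣) (∣ v ∣) _ 4P≤a² (lucas-growth a P 4P≤a² r) au≤
  where
  u v : ℤ
  u = lucas a P (suc r)
  v = lucas a P r
  au≤ : ∣ a ∣ ℕ.* ∣ u ∣ ℕ.≤ ∣ a ℤ.* u ℤ.- P ℤ.* v ∣ ℕ.+ ∣ P ∣ ℕ.* ∣ v ∣
  au≤ = subst (ℕ._≤ ∣ a ℤ.* u ℤ.- P ℤ.* v ∣ ℕ.+ ∣ P ∣ ℕ.* ∣ v ∣) (ℤ.∣i*j∣≡∣i∣*∣j∣ a u)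
         (subst (λ x → ∣ a ℤ.* u ∣ ℕ.≤ ∣ a ℤ.* u ℤ.- P ℤ.* v ∣ ℕ.+ x) (ℤ.∣i*j∣≡∣i∣*∣j∣ P v)
           (∣i∣≤∣i-j∣+∣j∣ (a ℤ.* u) (P ℤ.* v)))

-- By the growth estimate a zero at `suc r` gives |a| |uᵣ| ≤ 0, hence a zero at `r`, and so on down
-- to u₀ = 1.
lucas≢0 : ∀ a P → a ≢ 0ℤ → 4 ℕ.* ∣ P ∣ ℕ.≤ ∣ a ∣ ℕ.* ∣ a ∣ → ∀ r → lucas a P r ≢ 0ℤ
lucas≢0 a P a≢0 4P≤a² zero    ()
lucas≢0 a P a≢0 4P≤a² (suc r) u≡0 =
  [ a≢0 ∘ ℤ.∣i∣≡0⇒i≡0 , lucas≢0 a P a≢0 4P≤a² r ∘ ℤ.∣i∣≡0⇒i≡0 ]′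
    (ℕ.m*n≡0⇒m≡0∨n≡0 ∣ a ∣ (ℕ.n≤0⇒n≡0
      (subst (λ x → ∣ a ∣ ℕ.* ∣ lucas a P r ∣ ℕ.≤ 2 ℕ.* ∣ x ∣) u≡0 (lucas-growth a P 4P≤a² r))))

∣⇒≡p*j : ∀ {p} i → + p ℤ.∣ i → ∃[ j ] i ≡ + p ℤ.* j
∣⇒≡p*j {p} i (ℤ.divides q eq) = q , trans eq (ℤ.*-comm q (+ p))

prime<4⇒≡2⊎≡3 : ∀ {p} → Prime p → p ℕ.< 4 → p ≡ 2 ⊎ p ≡ 3
prime<4⇒≡2⊎≡3 {0} p-prime _ = contradiction (prime⇒nonTrivial p-prime) (λ ())
prime<4⇒≡2⊎≡3 {1} p-prime _ = contradiction (prime⇒nonTrivial p-prime) (λ ())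
prime<4⇒≡2⊎≡3 {2} _ _ = inj₁ refl
prime<4⇒≡2⊎≡3 {3} _ _ = inj₂ refl
prime<4⇒≡2⊎≡3 {suc (suc (suc (suc _)))} _ (s≤s (s≤s (s≤s (s≤s ()))))

^≢0 : ∀ p .{{_ : NonZero p}} r → (+ p) ℤ.^ r ≢ 0ℤ
^≢0 p zero ()
^≢0 p (suc r) eq with ℤ.i*j≡0⇒i≡0∨j≡0 (+ p) eq
... | inj₁ p≡0 = contradiction (ℤ.+-injective p≡0) (ℕ.≢-nonZero⁻¹ p)
... | inj₂ q≡0 = ^≢0 p r q≡0

-- Induction on `e`, with `P` an odd power of `p` throughout. For k = 2(e + 1) the value found for
-- |a| is p^(k/2), exactly what the theorem excludes at 2 and 3.
lucas-zero : ∀ {p} → Prime p → ∀ e a r → a ≢ 0ℤ → lucas a (+ (p ^ℕ suc (e ℕ.* 2))) r ≡ 0ℤ →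
  (p ≡ 2 ⊎ p ≡ 3) × ∣ a ∣ ≡ p ^ℕ suc e
lucas-zero p-prime e a zero a≢0 ()
lucas-zero {p} p-prime e a (suc r) a≢0 u≡0
  with ∣⇒≡p*j a (prime∣lucas⇒∣ a (+ (p ^ℕ suc (e ℕ.* 2))) r p-prime (∣ᵤ⇒∣ (m∣m*n (p ^ℕ (e ℕ.* 2))))
                     (subst (+ p ℤ.∣_) (sym u≡0) (∣ᵤ⇒∣ (divides 0 refl))))
-- Now `P` is p² times the next lower odd power of `p`, and a = p b. Scaling by `p` pulls the
-- nonzero factor p^(r+1) out of the vanishing term, so the sequence for `b` and the smaller power
-- vanishes at the same index.
lucas-zero {p} p-prime (suc e) a (suc r) a≢0 u≡0 | b , refl
  with lucas-zero p-prime e b (suc r) (λ { refl → a≢0 (ℤ.*-zeroʳ (+ p)) }) u′≡0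
  where
  instance _ = prime⇒nonZero p-prime
  P : ℕ
  P = p ^ℕ suc (e ℕ.* 2)
  P≡ : + (p ℕ.* (p ℕ.* P)) ≡ + p ℤ.* (+ p ℤ.* + P)
  P≡ = trans (ℤ.pos-* p (p ℕ.* P)) (cong (+ p ℤ.*_) (ℤ.pos-* p P))
  u′≡0 : lucas b (+ P) (suc r) ≡ 0ℤ
  u′≡0 = [ (λ eq → contradiction eq (^≢0 p (suc r))) , id ]′ (ℤ.i*j≡0⇒i≡0∨j≡0 ((+ p) ℤ.^ suc r)
    (trans (sym (lucas-scale (+ p) b (+ P) (suc r)))
           (trans (cong (λ x → lucas (+ p ℤ.* b) x (suc r)) (sym P≡)) u≡0)))
... | p≡2⊎3 , ∣b∣≡ = p≡2⊎3 , trans (ℤ.∣i*j∣≡∣i∣*∣j∣ (+ p) b) (cong (p ℕ.*_) ∣b∣≡)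
lucas-zero {p} p-prime zero a (suc r) a≢0 u≡0 | b , refl = case-b ∣ b ∣ refl
  where
  instance _ = prime⇒nonZero p-prime
  square : ∀ p b → p ℕ.* b ℕ.* (p ℕ.* b) ≡ p ℕ.* (b ℕ.* b) ℕ.* p
  square = ℕ-Solver.solve-∀
  -- Since a² = p (p b²) and P = p here, 4 ≤ p b² would make the discriminant a² - 4P nonnegative,
  -- and then no term vanishes.
  small : ¬ 4 ℕ.≤ p ℕ.* (∣ b ∣ ℕ.* ∣ b ∣)
  small 4≤pb² = lucas≢0 a (+ (p ^ℕ 1)) a≢0
    (ℕ.≤-trans (ℕ.≤-reflexive (cong (4 ℕ.*_) (ℕ.*-identityʳ p)))
      (ℕ.≤-trans (ℕ.*-monoˡ-≤ p 4≤pb²)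
        (ℕ.≤-reflexive (trans (sym (square p ∣ b ∣)) (sym (cong₂ ℕ._*_ ∣a∣≡ ∣a∣≡))))))
    (suc r) u≡0
    where
    ∣a∣≡ : ∣ a ∣ ≡ p ℕ.* ∣ b ∣
    ∣a∣≡ = ℤ.∣i*j∣≡∣i∣*∣j∣ (+ p) b
  case-b : ∀ n → ∣ b ∣ ≡ n → (p ≡ 2 ⊎ p ≡ 3) × ∣ a ∣ ≡ p ^ℕ 1
  case-b 0 ∣b∣≡0 = contradiction (trans (cong (+ p ℤ.*_) (ℤ.∣i∣≡0⇒i≡0 ∣b∣≡0)) (ℤ.*-zeroʳ (+ p))) a≢0
  case-b 1 ∣b∣≡1 =
    prime<4⇒≡2⊎≡3 p-prime
      (ℕ.≰⇒> (λ 4≤p → small (subst (4 ℕ.≤_)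
        (trans (sym (ℕ.*-identityʳ p)) (cong (λ x → p ℕ.* (x ℕ.* x)) (sym ∣b∣≡1))) 4≤p)))
    , trans (ℤ.∣i*j∣≡∣i∣*∣j∣ (+ p) b) (cong (p ℕ.*_) ∣b∣≡1)
  case-b (suc (suc n)) ∣b∣≡ = contradiction
    (ℕ.≤-trans (ℕ.*-mono-≤ {2} {∣ b ∣} {2} {∣ b ∣} 2≤b 2≤b) (ℕ.m≤n*m (∣ b ∣ ℕ.* ∣ b ∣) p)) small
    where
    2≤b : 2 ℕ.≤ ∣ b ∣
    2≤b = subst (2 ℕ.≤_) (sym ∣b∣≡) (s≤s (s≤s z≤n))

-- Elementary arithmetic

least : ∀ {P : ℕ → Set} → Decidable P → ∃[ n ] P n → ∃[ n ] IsLeast P n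
least {P} P? (n , Pn) = <-rec (λ n → P n → ∃[ m ] IsLeast P m) step n Pn
  where
  step : ∀ n → (∀ {m} → m ℕ.< n → P m → ∃[ l ] IsLeast P l) → P n → ∃[ l ] IsLeast P l
  step n rec Pn with ℕ.anyUpTo? P? n
  ... | yes (m , m<n , Pm) = rec m<n Pm
  ... | no  none           = n , Pn , λ m Pm → ℕ.≮⇒≥ (λ m<n → none (m , m<n , Pm))

prime-divisor : ∀ n .{{_ : NonZero n}} → n ≢ 1 → ∃[ p ] Prime p × p ℕ.∣ n
prime-divisor n n≢1 with factorise n
... | record { factors = [] ; isFactorisation = eq } = contradiction eq n≢1
... | record { factors = p ∷ ps ; isFactorisation = refl ; factorsPrime = p-prime ∷ _ } =
  p , p-prime , m∣m*n _

split-prime-power : ∀ {p} → Prime p → ∀ n → n ≢ 0 →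
  ∃[ r ] ∃[ m ] n ≡ p ^ℕ r ℕ.* m × ¬ p ℕ.∣ m
split-prime-power {p} p-prime = <-rec Split step
  where
  Split : ℕ → Set
  Split n = n ≢ 0 → ∃[ r ] ∃[ m ] n ≡ p ^ℕ r ℕ.* m × ¬ p ℕ.∣ m
  rearrange : ∀ x m p → x ℕ.* m ℕ.* p ≡ p ℕ.* x ℕ.* m
  rearrange = ℕ-Solver.solve-∀
  step : ∀ n → (∀ {m} → m ℕ.< n → Split m) → Split n
  step n rec n≢0 with p ∣? n
  ... | no p∤n = 0 , n , sym (ℕ.*-identityˡ n) , p∤n
  ... | yes (divides zero refl) = contradiction refl n≢0
  ... | yes (divides q@(suc _) refl)
    with rec (ℕ.m<m*n q p (ℕ.nonTrivial⇒n>1 p {{prime⇒nonTrivial p-prime}})) (λ ())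
  ...   | r , m , q≡ , p∤m = suc r , m , trans (cong (ℕ._* p) q≡) (rearrange (p ^ℕ r) m p) , p∤m

-- Congruences for _≈_ and the embedding of ℤ

∣p-q∣≡∣q-p∣ : ∀ p q → ℚ.∣ p ℚ.- q ∣ ≡ ℚ.∣ q ℚ.- p ∣
∣p-q∣≡∣q-p∣ p q = trans (cong ℚ.∣_∣ (swap p q)) (ℚ.∣-p∣≡∣p∣ (q ℚ.- p))
  where
  open +-*-Solver
  swap : ∀ p q → p ℚ.- q ≡ ℚ.- (q ℚ.- p)
  swap = solve 2 (λ p q → p :- q := :- (q :- p)) refl

norm-swap : ∀ x y m → norm (x - y) m ≡ norm (y - x) m
norm-swap x y m = cong₂ ℚ._+_ (∣p-q∣≡∣q-p∣ (re (x m)) (re (y m))) (∣p-q∣≡∣q-p∣ (im (x m)) (im (y m)))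

norm-+ : ∀ x y m → norm (x + y) m ℚ.≤ norm x m ℚ.+ norm y m
norm-+ x y m = ℚ.≤-trans
  (ℚ.+-mono-≤ (ℚ.∣p+q∣≤∣p∣+∣q∣ (re (x m)) (re (y m))) (ℚ.∣p+q∣≤∣p∣+∣q∣ (im (x m)) (im (y m))))
  (ℚ.≤-reflexive (interchange (ℚ.∣ re (x m) ∣) (ℚ.∣ re (y m) ∣) (ℚ.∣ im (x m) ∣) (ℚ.∣ im (y m) ∣)))
  where
  open +-*-Solver
  interchange : ∀ a b c d → (a ℚ.+ b) ℚ.+ (c ℚ.+ d) ≡ (a ℚ.+ c) ℚ.+ (b ℚ.+ d)
  interchange = solve 4 (λ a b c d → (a :+ b) :+ (c :+ d) := (a :+ c) :+ (b :+ d)) refl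

norm-* : ∀ x y m → norm (x * y) m ℚ.≤ norm x m ℚ.* norm y m
norm-* x y m = ℚ.≤-trans
  (ℚ.+-mono-≤ (ℚ.∣p-q∣≤∣p∣+∣q∣ (a ℚ.* c) (b ℚ.* d)) (ℚ.∣p+q∣≤∣p∣+∣q∣ (a ℚ.* d) (b ℚ.* c)))
  (ℚ.≤-reflexive (trans
    (cong₂ ℚ._+_ (cong₂ ℚ._+_ (ℚ.∣p*q∣≡∣p∣*∣q∣ a c) (ℚ.∣p*q∣≡∣p∣*∣q∣ b d))
                 (cong₂ ℚ._+_ (ℚ.∣p*q∣≡∣p∣*∣q∣ a d) (ℚ.∣p*q∣≡∣p∣*∣q∣ b c)))
    (factor (ℚ.∣ a ∣) (ℚ.∣ b ∣) (ℚ.∣ c ∣) (ℚ.∣ d ∣))))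
  where
  open +-*-Solver
  a b c d : ℚ
  a = re (x m)
  b = im (x m)
  c = re (y m)
  d = im (y m)
  factor : ∀ a b c d → (a ℚ.* c ℚ.+ b ℚ.* d) ℚ.+ (a ℚ.* d ℚ.+ b ℚ.* c) ≡ (a ℚ.+ b) ℚ.* (c ℚ.+ d)
  factor = solve 4 (λ a b c d → (a :* c :+ b :* d) :+ (a :* d :+ b :* c) := (a :+ b) :* (c :+ d)) refl

0≤norm : ∀ x m → 0ℚ ℚ.≤ norm x m
0≤norm x m = ℚ.+-mono-≤ {0ℚ} {ℚ.∣ re (x m) ∣} {0ℚ} (ℚ.0≤∣p∣ (re (x m))) (ℚ.0≤∣p∣ (im (x m)))

-- The relation _≈_ does not determine its endpoints for unification; the wrapper does.
infix 4 _≋_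
record _≋_ (x y : Seqℂ) : Set where
  constructor ⌈_⌉
  field
    ⌊_⌋ : x ≈ y

≡⇒≋ : ∀ {x y} → (∀ m → x m ≡ y m) → x ≋ y
≡⇒≋ {x} {y} x≡y = ⌈ (λ η 0<η → 0 , λ m _ →
  ℚ.≤-trans (ℚ.≤-reflexive (norm≡0 m))
            (ℚ.≤-trans (ℚ.<⇒≤ 0<η) (ℚ.≤-reflexive (sym (ℚ.+-identityˡ η))))) ⌉
  where
  norm≡0 : ∀ m → norm (x - y) m ≡ 0ℚ
  norm≡0 m rewrite x≡y m = trans (cong₂ ℚ._+_ (∣p-p∣≡0 (re (y m))) (∣p-p∣≡0 (im (y m)))) (ℚ.+-identityˡ 0ℚ)
    where
    ∣p-p∣≡0 : ∀ p → ℚ.∣ p ℚ.- p ∣ ≡ 0ℚ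
    ∣p-p∣≡0 p = cong ℚ.∣_∣ (ℚ.+-inverseʳ p)

≋-sym : ∀ {x y} → x ≋ y → y ≋ x
≋-sym {x} {y} ⌈ x≈y ⌉ = ⌈ (λ η 0<η → let N , bound = x≈y η 0<η in
  N , λ m N≤m → subst (ℚ._≤ 0ℚ ℚ.+ η) (norm-swap x y m) (bound m N≤m)) ⌉

-- Each of the two given relations receives half of the slack η. Transitivity and compatibility with
-- addition thereby reduce to a triangle inequality at every index.
≋-from-sum : ∀ {x y u v u′ v′} → u ≋ v → u′ ≋ v′ →
  (∀ m → norm (x - y) m ℚ.≤ norm (u - v) m ℚ.+ norm (u′ - v′) m) → x ≋ y
≋-from-sum {x} {y} ⌈ u≈v ⌉ ⌈ u′≈v′ ⌉ bound = ⌈ x≈y ⌉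
  where
  open +-*-Solver
  0<½η : ∀ {η} → 0ℚ ℚ.< η → 0ℚ ℚ.< ½ ℚ.* η
  0<½η {η} 0<η = subst (ℚ._< ½ ℚ.* η) (ℚ.*-zeroʳ ½) (ℚ.*-monoʳ-<-pos ½ 0<η)
  halves : ∀ η → (0ℚ ℚ.+ ½ ℚ.* η) ℚ.+ (0ℚ ℚ.+ ½ ℚ.* η) ≡ 0ℚ ℚ.+ η
  halves = solve 1 (λ η → (con 0ℚ :+ con ½ :* η) :+ (con 0ℚ :+ con ½ :* η) := con 0ℚ :+ η) refl
  x≈y : x ≈ y
  x≈y η 0<η with u≈v (½ ℚ.* η) (0<½η 0<η) | u′≈v′ (½ ℚ.* η) (0<½η 0<η)
  ... | N , b | N′ , b′ = N ℕ.⊔ N′ , λ m N≤m → ℚ.≤-trans (bound m) (ℚ.≤-trans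
    (ℚ.+-mono-≤ (b m (ℕ.m⊔n≤o⇒m≤o N N′ N≤m)) (b′ m (ℕ.m⊔n≤o⇒n≤o N N′ N≤m)))
    (ℚ.≤-reflexive (halves η)))

≋-trans : ∀ {x y z} → x ≋ y → y ≋ z → x ≋ z
≋-trans {x} {y} {z} x≈y y≈z = ≋-from-sum x≈y y≈z λ m →
  subst (ℚ._≤ norm (x - y) m ℚ.+ norm (y - z) m)
        (cong ‖_‖ (cong₂ _+i_ (cancel (re (x m)) (re (y m)) (re (z m))) (cancel (im (x m)) (im (y m)) (im (z m)))))
        (norm-+ (x - y) (y - z) m)
  where
  open +-*-Solver
  cancel : ∀ a b c → (a ℚ.- b) ℚ.+ (b ℚ.- c) ≡ a ℚ.- c
  cancel = solve 3 (λ a b c → (a :- b) :+ (b :- c) := a :- c) refl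

≋-refl : ∀ {x} → x ≋ x
≋-refl = ≡⇒≋ (λ _ → refl)

≋-reflexive : ∀ {x y} → x ≡ y → x ≋ y
≋-reflexive refl = ≋-refl

≋-setoid : Setoid _ _
≋-setoid = record { Carrier = Seqℂ ; _≈_ = _≋_
                  ; isEquivalence = record { refl = ≋-refl ; sym = ≋-sym ; trans = ≋-trans } }

module ≋-Reasoning = ≈-Reasoning ≋-setoid

+-cong : ∀ {x y x′ y′} → x ≋ y → x′ ≋ y′ → x + x′ ≋ y + y′
+-cong {x} {y} {x′} {y′} x≈y x′≈y′ = ≋-from-sum x≈y x′≈y′ λ m →
  subst (ℚ._≤ norm (x - y) m ℚ.+ norm (x′ - y′) m)
        (cong ‖_‖ (cong₂ _+i_ (interchange (re (x m)) (re (y m)) (re (x′ m)) (re (y′ m)))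
                              (interchange (im (x m)) (im (y m)) (im (x′ m)) (im (y′ m)))))
        (norm-+ (x - y) (x′ - y′) m)
  where
  open +-*-Solver
  interchange : ∀ a b c d → (a ℚ.- b) ℚ.+ (c ℚ.- d) ≡ (a ℚ.+ c) ℚ.- (b ℚ.+ d)
  interchange = solve 4 (λ a b c d → (a :- b) :+ (c :- d) := (a :+ c) :- (b :+ d)) refl

-- Products with bounded sequences

-- A bound from some index on suffices, since `_≈_` only concerns large indices. Positivity of `B`
-- allows dividing by it in `*-congˡ`.
Bounded : Seqℂ → Set
Bounded x = ∃[ B ] Positive B × ∃[ N ] ∀ m → N ℕ.≤ m → norm x m ℚ.≤ B

norm-within-1 : ∀ x z m → norm (x - constℂ z) m ℚ.≤ 1ℚ → norm x m ℚ.≤ 1ℚ ℚ.+ ‖ z ‖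
norm-within-1 x z m close = ℚ.≤-trans
  (subst (ℚ._≤ norm (x - constℂ z) m ℚ.+ ‖ z ‖)
         (cong ‖_‖ (cong₂ _+i_ (cancel (re (x m)) (re z)) (cancel (im (x m)) (im z))))
         (norm-+ (x - constℂ z) (constℂ z) m))
  (ℚ.+-monoˡ-≤ ‖ z ‖ close)
  where
  open +-*-Solver
  cancel : ∀ a b → (a ℚ.- b) ℚ.+ b ≡ a
  cancel = solve 2 (λ a b → (a :- b) :+ b := a) refl

cauchy⇒bounded : ∀ x → IsCauchy x → Bounded x
cauchy⇒bounded x x-cauchy with x-cauchy 1ℚ (ℚ.positive⁻¹ 1ℚ)
... | N , close = 1ℚ ℚ.+ ‖ x N ‖ , ℚ.pos+nonNeg⇒pos 1ℚ ‖ x N ‖ {{ℚ.nonNegative (0≤norm x N)}} , N ,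
  λ m N≤m → norm-within-1 x (x N) m (close m N N≤m ℕ.≤-refl)

≋const⇒bounded : ∀ {x z} → x ≋ constℂ z → Bounded x
≋const⇒bounded {x} {z} ⌈ x≈z ⌉ with x≈z 1ℚ (ℚ.positive⁻¹ 1ℚ)
... | N , close = 1ℚ ℚ.+ ‖ z ‖ , ℚ.pos+nonNeg⇒pos 1ℚ ‖ z ‖ {{ℚ.nonNegative (0≤norm (constℂ z) 0)}} , N ,
  λ m N≤m → norm-within-1 x z m (close m N≤m)

-- An unbounded factor could magnify a difference that tends to 0, hence the bound `B` on `x`. The
-- difference of `y` and `z` is taken within η / B, and the product with `x` stays within η.
*-congˡ : ∀ {x y z} → Bounded x → y ≋ z → x * y ≋ x * z
*-congˡ {x} {y} {z} (B , B-pos , M , x≤B) ⌈ y≈z ⌉ = ⌈ xy≈xz ⌉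
  where
  open ℚ.≤-Reasoning
  open +-*-Solver
  instance
    _ = B-pos
    _ = ℚ.pos⇒nonZero B
    _ = ℚ.pos⇒nonNeg B
    _ = ℚ.1/pos⇒pos B
  0<η/B : ∀ {η} → 0ℚ ℚ.< η → 0ℚ ℚ.< ℚ.1/ B ℚ.* η
  0<η/B {η} 0<η = subst (ℚ._< ℚ.1/ B ℚ.* η) (ℚ.*-zeroʳ (ℚ.1/ B)) (ℚ.*-monoʳ-<-pos (ℚ.1/ B) 0<η)
  rearrange : ∀ b c η → b ℚ.* (0ℚ ℚ.+ c ℚ.* η) ≡ 0ℚ ℚ.+ b ℚ.* c ℚ.* η
  rearrange = solve 3 (λ b c η → b :* (con 0ℚ :+ c :* η) := con 0ℚ :+ b :* c :* η) refl
  distrib-re : ∀ a b c d e f → (a ℚ.* c ℚ.- b ℚ.* d) ℚ.- (a ℚ.* e ℚ.- b ℚ.* f)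
             ≡ a ℚ.* (c ℚ.- e) ℚ.- b ℚ.* (d ℚ.- f)
  distrib-re = solve 6 (λ a b c d e f → (a :* c :- b :* d) :- (a :* e :- b :* f)
             := a :* (c :- e) :- b :* (d :- f)) refl
  distrib-im : ∀ a b c d e f → (a ℚ.* d ℚ.+ b ℚ.* c) ℚ.- (a ℚ.* f ℚ.+ b ℚ.* e)
             ≡ a ℚ.* (d ℚ.- f) ℚ.+ b ℚ.* (c ℚ.- e)
  distrib-im = solve 6 (λ a b c d e f → (a :* d :+ b :* c) :- (a :* f :+ b :* e)
             := a :* (d :- f) :+ b :* (c :- e)) refl
  xy≈xz : x * y ≈ x * z
  xy≈xz η 0<η with y≈z (ℚ.1/ B ℚ.* η) (0<η/B 0<η)
  ... | N , y-z≤ = M ℕ.⊔ N , λ m N≤m → begin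
    norm (x * y - x * z) m          ≡⟨ cong ‖_‖ (cong₂ _+i_
      (distrib-re (re (x m)) (im (x m)) (re (y m)) (im (y m)) (re (z m)) (im (z m)))
      (distrib-im (re (x m)) (im (x m)) (re (y m)) (im (y m)) (re (z m)) (im (z m)))) ⟩
    norm (x * (y - z)) m            ≤⟨ norm-* x (y - z) m ⟩
    norm x m ℚ.* norm (y - z) m     ≤⟨ ℚ.*-monoʳ-≤-nonNeg (norm (y - z) m) {{ℚ.nonNegative (0≤norm (y - z) m)}}
                                         (x≤B m (ℕ.m⊔n≤o⇒m≤o M N N≤m)) ⟩
    B ℚ.* norm (y - z) m            ≤⟨ ℚ.*-monoˡ-≤-nonNeg B (y-z≤ m (ℕ.m⊔n≤o⇒n≤o M N N≤m)) ⟩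
    B ℚ.* (0ℚ ℚ.+ ℚ.1/ B ℚ.* η)     ≡⟨ rearrange B (ℚ.1/ B) η ⟩
    0ℚ ℚ.+ B ℚ.* ℚ.1/ B ℚ.* η       ≡⟨ cong (λ c → 0ℚ ℚ.+ c ℚ.* η) (ℚ.*-inverseʳ B) ⟩
    0ℚ ℚ.+ 1ℚ ℚ.* η                 ≡⟨ cong (0ℚ ℚ.+_) (ℚ.*-identityˡ η) ⟩
    0ℚ ℚ.+ η                        ∎

*-fromℕ1 : ∀ x → x ≋ x * fromℕ 1
*-fromℕ1 x = ≡⇒≋ λ m → cong₂ _+i_ (real (re (x m)) (im (x m))) (imaginary (re (x m)) (im (x m)))
  where
  open +-*-Solver
  real : ∀ a b → a ≡ a ℚ.* 1ℚ ℚ.- b ℚ.* 0ℚ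
  real = solve 2 (λ a b → a := a :* con 1ℚ :- b :* con 0ℚ) refl
  imaginary : ∀ a b → b ≡ a ℚ.* 0ℚ ℚ.+ b ℚ.* 1ℚ
  imaginary = solve 2 (λ a b → b := a :* con 0ℚ :+ b :* con 1ℚ) refl

*-comm : ∀ x y → x * y ≋ y * x
*-comm x y = ≡⇒≋ λ m → cong₂ _+i_
  (cong₂ ℚ._-_ (ℚ.*-comm (re (x m)) (re (y m))) (ℚ.*-comm (im (x m)) (im (y m))))
  (trans (ℚ.+-comm (re (x m) ℚ.* im (y m)) (im (x m) ℚ.* re (y m)))
         (cong₂ ℚ._+_ (ℚ.*-comm (im (x m)) (re (y m))) (ℚ.*-comm (re (x m)) (im (y m)))))

-- Integers as constant sequences

/1-+ : ∀ i j → (i ℤ.+ j) ℚ./ 1 ≡ i ℚ./ 1 ℚ.+ j ℚ./ 1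
/1-+ i j = ℚ.toℚᵘ-injective (begin-equality
  toℚᵘ ((i ℤ.+ j) ℚ./ 1)               ≃⟨ ℚ.toℚᵘ-fromℚᵘ (mkℚᵘ (i ℤ.+ j) 0) ⟩
  mkℚᵘ (i ℤ.+ j) 0                      ≃⟨ *≡* (cong (ℤ._* 1ℤ) (sym (cong₂ ℤ._+_ (ℤ.*-identityʳ i) (ℤ.*-identityʳ j)))) ⟩
  mkℚᵘ i 0 ℚᵘ.+ mkℚᵘ j 0                ≃⟨ ℚᵘ.≃-sym (ℚᵘ.+-cong (ℚ.toℚᵘ-fromℚᵘ (mkℚᵘ i 0)) (ℚ.toℚᵘ-fromℚᵘ (mkℚᵘ j 0))) ⟩
  toℚᵘ (i ℚ./ 1) ℚᵘ.+ toℚᵘ (j ℚ./ 1)    ≃⟨ ℚᵘ.≃-sym (ℚ.toℚᵘ-homo-+ (i ℚ./ 1) (j ℚ./ 1)) ⟩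
  toℚᵘ (i ℚ./ 1 ℚ.+ j ℚ./ 1)            ∎)
  where open ℚᵘ.≤-Reasoning

/1-* : ∀ i j → (i ℤ.* j) ℚ./ 1 ≡ (i ℚ./ 1) ℚ.* (j ℚ./ 1)
/1-* i j = ℚ.toℚᵘ-injective (begin-equality
  toℚᵘ ((i ℤ.* j) ℚ./ 1)               ≃⟨ ℚ.toℚᵘ-fromℚᵘ (mkℚᵘ (i ℤ.* j) 0) ⟩
  mkℚᵘ i 0 ℚᵘ.* mkℚᵘ j 0                ≃⟨ ℚᵘ.≃-sym (ℚᵘ.*-cong (ℚ.toℚᵘ-fromℚᵘ (mkℚᵘ i 0)) (ℚ.toℚᵘ-fromℚᵘ (mkℚᵘ j 0))) ⟩
  toℚᵘ (i ℚ./ 1) ℚᵘ.* toℚᵘ (j ℚ./ 1)    ≃⟨ ℚᵘ.≃-sym (ℚ.toℚᵘ-homo-* (i ℚ./ 1) (j ℚ./ 1)) ⟩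
  toℚᵘ ((i ℚ./ 1) ℚ.* (j ℚ./ 1))            ∎)
  where open ℚᵘ.≤-Reasoning

/1-injective : ∀ {i j} → i ℚ./ 1 ≡ j ℚ./ 1 → i ≡ j
/1-injective {i} {j} eq with ℚ.fromℚᵘ-injective {mkℚᵘ i 0} {mkℚᵘ j 0} eq
... | *≡* i1≡j1 = trans (sym (ℤ.*-identityʳ i)) (trans i1≡j1 (ℤ.*-identityʳ j))

fromℤ-+ : ∀ i j → fromℤ (i ℤ.+ j) ≋ fromℤ i + fromℤ j
fromℤ-+ i j = ≡⇒≋ λ _ → cong (_+i 0ℚ) (/1-+ i j)

fromℤ-* : ∀ i j → fromℤ (i ℤ.* j) ≋ fromℤ i * fromℤ j
fromℤ-* i j = ≡⇒≋ λ _ → cong₂ _+i_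
  (trans (/1-* i j) (real (i ℚ./ 1) (j ℚ./ 1))) (imaginary (i ℚ./ 1) (j ℚ./ 1))
  where
  open +-*-Solver
  real : ∀ a b → a ℚ.* b ≡ a ℚ.* b ℚ.- 0ℚ ℚ.* 0ℚ
  real = solve 2 (λ a b → a :* b := a :* b :- con 0ℚ :* con 0ℚ) refl
  imaginary : ∀ a b → 0ℚ ≡ a ℚ.* 0ℚ ℚ.+ 0ℚ ℚ.* b
  imaginary = solve 2 (λ a b → con 0ℚ := a :* con 0ℚ :+ con 0ℚ :* b) refl

fromℤ-injective : ∀ {i j} → fromℤ i ≋ fromℤ j → i ≡ j
fromℤ-injective {i} {j} ⌈ i≈j ⌉ = /1-injective (p-q≡0⇒p≡q (i ℚ./ 1) (j ℚ./ 1)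
  (ℚ.∣p∣≡0⇒p≡0 d (ℚ.≤-antisym (ℚ.≮⇒≥ ¬0<∣d∣) (ℚ.0≤∣p∣ d))))
  where
  open +-*-Solver
  d : ℚ
  d = i ℚ./ 1 ℚ.- j ℚ./ 1
  ¬0<∣d∣ : 0ℚ ℚ.< ℚ.∣ d ∣ → _
  -- Both sequences are constant, so closeness within η at a single index already gives |d| ≤ η. A
  -- choice of η strictly between 0 and |d| contradicts this.
  ¬0<∣d∣ 0<∣d∣ with ℚ.<-dense 0<∣d∣
  ... | η , 0<η , η<∣d∣ with i≈j η 0<η
  ...   | N , close = ℚ.<-irrefl refl (ℚ.<-≤-trans η<∣d∣
    (subst (ℚ._≤ η) (ℚ.+-identityʳ _)
           (subst (norm (fromℤ i - fromℤ j) N ℚ.≤_) (ℚ.+-identityˡ η) (close N ℕ.≤-refl))))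
  p-q≡0⇒p≡q : ∀ p q → p ℚ.- q ≡ 0ℚ → p ≡ q
  p-q≡0⇒p≡q p q p-q≡0 = trans (cancel p q) (trans (cong (ℚ._+ q) p-q≡0) (ℚ.+-identityˡ q))
    where
    cancel : ∀ p q → p ≡ (p ℚ.- q) ℚ.+ q
    cancel = solve 2 (λ p q → p := (p :- q) :+ q) refl

-- One factor is replaced at a time, with commutativity moving the other to the left. Boundedness
-- comes from being equivalent to a constant.
*-cong-fromℤ : ∀ {x y i j} → x ≋ fromℤ i → y ≋ fromℤ j → x * y ≋ fromℤ (i ℤ.* j)
*-cong-fromℤ {x} {y} {i} {j} x≋i y≋j = begin
  x * y              ≈⟨ *-congˡ {x} (≋const⇒bounded x≋i) y≋j ⟩
  x * fromℤ j        ≈⟨ *-comm x (fromℤ j) ⟩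
  fromℤ j * x        ≈⟨ *-congˡ {fromℤ j} (≋const⇒bounded {z = (j ℚ./ 1) +i 0ℚ} ≋-refl) x≋i ⟩
  fromℤ j * fromℤ i  ≈⟨ *-comm (fromℤ j) (fromℤ i) ⟩
  fromℤ i * fromℤ j  ≈⟨ fromℤ-* i j ⟨
  fromℤ (i ℤ.* j)    ∎
  where open ≋-Reasoning

+-cong-fromℤ : ∀ {x y i j} → x ≋ fromℤ i → y ≋ fromℤ j → x + y ≋ fromℤ (i ℤ.+ j)
+-cong-fromℤ {i = i} {j} x≋i y≋j = ≋-trans (+-cong x≋i y≋j) (≋-sym (fromℤ-+ i j))

fromℕ-^ : ∀ p e → fromℕ p ^ e ≋ fromℕ (p ^ℕ e)
fromℕ-^ p zero    = ≋-refl
fromℕ-^ p (suc e) = begin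
  fromℕ p * fromℕ p ^ e       ≈⟨ *-cong-fromℤ {fromℕ p} {i = + p} {+ (p ^ℕ e)} ≋-refl (fromℕ-^ p e) ⟩
  fromℤ (+ p ℤ.* + (p ^ℕ e))  ≡⟨ cong fromℤ (ℤ.pos-* p (p ^ℕ e)) ⟨
  fromℕ (p ^ℕ suc e)          ∎
  where open ≋-Reasoning

-- Hecke relations over ℤ

module _ (c : ℕ → Seqℂ) {p : ℕ} where

  coeffAtQuotient-multiple : ∀ m .{{_ : NonZero p}} → coeffAtQuotient c (p ℕ.* m) p ≡ c m
  coeffAtQuotient-multiple m with p ∣? (p ℕ.* m)
  ... | yes (divides m′ pm≡m′p) = cong c (sym (ℕ.*-cancelˡ-≡ m m′ p (trans pm≡m′p (ℕ.*-comm m′ p))))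
  ... | no  p∤pm                = contradiction (m∣m*n m) p∤pm

  coeffAtQuotient-nonmultiple : ∀ {n} → ¬ p ℕ.∣ n → coeffAtQuotient c n p ≡ fromℕ 0
  coeffAtQuotient-nonmultiple {n} p∤n with p ∣? n
  ... | yes p∣n = contradiction p∣n p∤n
  ... | no  _   = refl

module IntegralNewform {k} (f : Newform k) (a : ℕ → ℤ)
  (coeff≈a : ∀ n → approx (Newform.coeff f n) ≈ fromℤ (a n)) where

  private
    c : ℕ → Seqℂ
    c n = approx (Newform.coeff f n)

    c≋a : ∀ n → c n ≋ fromℤ (a n)
    c≋a n = ⌈ coeff≈a n ⌉

  a₁≡1 : a 1 ≡ 1ℤ
  a₁≡1 = fromℤ-injective (≋-trans (≋-sym (c≋a 1)) ⌈ Newform.normalized f ⌉)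

  module _ {p} (p-prime : Prime p) where

    private
      instance _ = prime⇒nonZero p-prime

      t : Seqℂ
      t = approx (proj₁ (Newform.eigenform f p p-prime))

      P : ℤ
      P = + (p ^ℕ (k ℕ.∸ 1))

      -- The integer `j` is the coefficient at n / p: 0 if `p` does not divide `n`, and `a m` if n =
      -- p m. Both Hecke relations are instances.
      t*c : ∀ n {j} → coeffAtQuotient c n p ≋ fromℤ j → t * c n ≋ fromℤ (a (p ℕ.* n) ℤ.+ P ℤ.* j)
      t*c n {j} quotient≋j = begin
        t * c n                            ≈⟨ ⌈ proj₂ (Newform.eigenform f p p-prime) n ⌉ ⟨
        c (p ℕ.* n) + fromℕ p ^ (k ℕ.∸ 1) * coeffAtQuotient c n p
          ≈⟨ +-cong-fromℤ {c (p ℕ.* n)} {i = a (p ℕ.* n)} {P ℤ.* j} (c≋a (p ℕ.* n))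
               (*-cong-fromℤ {fromℕ p ^ (k ℕ.∸ 1)} {i = P} {j} (fromℕ-^ p (k ℕ.∸ 1)) quotient≋j) ⟩
        fromℤ (a (p ℕ.* n) ℤ.+ P ℤ.* j)    ∎
        where open ≋-Reasoning

      i+P*0 : ∀ i P → i ℤ.+ P ℤ.* 0ℤ ≡ i
      i+P*0 = ℤ-Solver.solve-∀

      -- The eigenvalue is read off at n = 1, where the second Hecke term vanishes because `p` does
      -- not divide 1. Replacing `c 1` by 1 in the product requires `t` to be bounded, which it is
      -- as a Cauchy sequence.
      t≋aₚ : t ≋ fromℤ (a p)
      t≋aₚ = begin
        t              ≈⟨ *-fromℕ1 t ⟩
        t * fromℕ 1    ≈⟨ *-congˡ {t} t-bounded ⌈ Newform.normalized f ⌉ ⟨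
        t * c 1        ≈⟨ t*c 1 (≋-reflexive (coeffAtQuotient-nonmultiple c p∤1)) ⟩
        fromℤ (a (p ℕ.* 1) ℤ.+ P ℤ.* 0ℤ)  ≡⟨ cong fromℤ (trans (i+P*0 _ P) (cong a (ℕ.*-identityʳ p))) ⟩
        fromℤ (a p)    ∎
        where
        open ≋-Reasoning
        t-bounded : Bounded t
        t-bounded = cauchy⇒bounded t (cauchy (proj₁ (Newform.eigenform f p p-prime)))
        p∤1 : ¬ p ℕ.∣ 1
        p∤1 p∣1 = ℕ.nonTrivial⇒≢1 {{prime⇒nonTrivial p-prime}} (∣1⇒≡1 p∣1)

      aₚ*a : ∀ n {j} → coeffAtQuotient c n p ≋ fromℤ j → a (p ℕ.* n) ℤ.+ P ℤ.* j ≡ a p ℤ.* a n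
      aₚ*a n quotient≋j = fromℤ-injective (≋-trans (≋-sym (t*c n quotient≋j)) (*-cong-fromℤ {i = a p} {a n} t≋aₚ (c≋a n)))

    hecke-nonmultiple : ∀ {n} → ¬ p ℕ.∣ n → a (p ℕ.* n) ≡ a p ℤ.* a n
    hecke-nonmultiple {n} p∤n = trans (sym (i+P*0 (a (p ℕ.* n)) P))
      (aₚ*a n (≋-reflexive (coeffAtQuotient-nonmultiple c p∤n)))

    hecke-multiple : ∀ m → a (p ℕ.* (p ℕ.* m)) ≡ a p ℤ.* a (p ℕ.* m) ℤ.- P ℤ.* a m
    hecke-multiple m = trans (isolate (a (p ℕ.* (p ℕ.* m))) (P ℤ.* a m)) (cong (ℤ._- P ℤ.* a m)
      (aₚ*a (p ℕ.* m) (≋-trans (≋-reflexive (coeffAtQuotient-multiple c m)) (c≋a m))))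
      where
      isolate : ∀ i j → i ≡ i ℤ.+ j ℤ.- j
      isolate = ℤ-Solver.solve-∀

    -- As functions of `r` both sides satisfy the same second-order recurrence. They agree at 0, and
    -- at 1 by multiplicativity for `m` prime to `p`.
    coeff-prime-power : ∀ r {m} → ¬ p ℕ.∣ m → a (p ^ℕ r ℕ.* m) ≡ lucas (a p) P r ℤ.* a m
    coeff-prime-power zero          {m} _   = trans (cong a (ℕ.*-identityˡ m)) (sym (ℤ.*-identityˡ (a m)))
    coeff-prime-power (suc zero)    {m} p∤m =
      trans (cong (λ q → a (q ℕ.* m)) (ℕ.*-identityʳ p)) (hecke-nonmultiple p∤m)
    coeff-prime-power (suc (suc r)) {m} p∤m = begin
      a (p ℕ.* (p ℕ.* q) ℕ.* m)                           ≡⟨ cong a (reassoc p q m) ⟩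
      a (p ℕ.* (p ℕ.* (q ℕ.* m)))                         ≡⟨ hecke-multiple (q ℕ.* m) ⟩
      a p ℤ.* a (p ℕ.* (q ℕ.* m)) ℤ.- P ℤ.* a (q ℕ.* m)
        ≡⟨ cong₂ (λ x y → a p ℤ.* x ℤ.- P ℤ.* y)
             (trans (cong a (sym (ℕ.*-assoc p q m))) (coeff-prime-power (suc r) p∤m))
             (coeff-prime-power r p∤m) ⟩
      a p ℤ.* (lucas (a p) P (suc r) ℤ.* a m) ℤ.- P ℤ.* (lucas (a p) P r ℤ.* a m)
        ≡⟨ factor (a p) P (lucas (a p) P (suc r)) (lucas (a p) P r) (a m) ⟩
      lucas (a p) P (suc (suc r)) ℤ.* a m                 ∎
      where
      open ≡-Reasoning
      q : ℕ
      q = p ^ℕ r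
      reassoc : ∀ p q m → p ℕ.* (p ℕ.* q) ℕ.* m ≡ p ℕ.* (p ℕ.* (q ℕ.* m))
      reassoc = ℕ-Solver.solve-∀
      factor : ∀ i P u v j → i ℤ.* (u ℤ.* j) ℤ.- P ℤ.* (v ℤ.* j) ≡ (i ℤ.* u ℤ.- P ℤ.* v) ℤ.* j
      factor = ℤ-Solver.solve-∀

-- Primality of the least zero

theorem2p1 : (k : ℕ) → k > 0 → 2 ∣ k →
    (f : Newform k) (a : ℕ → ℤ) →
    (∀ n → approx (Newform.coeff f n) ≈ fromℤ (a n)) →
    ∣ a 2 ∣ ≢ 2 ^ℕ (k / 2) → ∣ a 3 ∣ ≢ 3 ^ℕ (k / 2) →
    (∃[ n ] (n ≥ 1 × a n ≡ 0ℤ)) →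
    ∃[ n ] (IsLeast (λ m → m ≥ 1 × a m ≡ 0ℤ) n × Prime n)
theorem2p1 _ () (divides zero refl)
-- With k = 2(e + 1) the exponent k - 1 computes to 2e + 1, the form that `lucas-zero` expects.
theorem2p1 _ _ (divides (suc e) refl) f a coeff≈a ∣a₂∣≢ ∣a₃∣≢ zeros
  with least (λ n → (1 ℕ.≤? n) ×-dec (a n ℤ.≟ 0ℤ)) zeros
... | n , n-least@((n≥1 , aₙ≡0) , n-minimal)
  -- The least zero is not 1 because a(1) = 1, so it has a prime factor.
  with prime-divisor n {{ℕ.>-nonZero n≥1}} (λ { refl → contradiction (trans (sym a₁≡1) aₙ≡0) (λ ()) })
  where open IntegralNewform f a coeff≈a
... | p , p-prime , p∣n with a p ℤ.≟ 0ℤ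
...   | yes aₚ≡0 = n , n-least , subst Prime (ℕ.≤-antisym p≤n n≤p) p-prime
  where
  p≤n : p ℕ.≤ n
  p≤n = ∣⇒≤ {{ℕ.>-nonZero n≥1}} p∣n
  n≤p : n ℕ.≤ p
  n≤p = n-minimal p (ℕ.>-nonZero⁻¹ p {{prime⇒nonZero p-prime}} , aₚ≡0)
...   | no  aₚ≢0 with split-prime-power p-prime n (λ { refl → contradiction n≥1 (λ ()) })
-- A zero at n = pʳ m kills a product of two integers, and each factor is shown to be nonzero.
...     | r , m , refl , p∤m = contradiction uᵣ*aₘ≡0 ([ uᵣ≢0 , aₘ≢0 ]′ ∘ ℤ.i*j≡0⇒i≡0∨j≡0 uᵣ)
  where
  open IntegralNewform f a coeff≈a
  P uᵣ : ℤ
  P  = + (p ^ℕ suc (e ℕ.* 2))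
  uᵣ = lucas (a p) P r
  uᵣ*aₘ≡0 : uᵣ ℤ.* a m ≡ 0ℤ
  uᵣ*aₘ≡0 = trans (sym (coeff-prime-power p-prime r p∤m)) aₙ≡0
  uᵣ≢0 : uᵣ ≢ 0ℤ
  uᵣ≢0 uᵣ≡0 with lucas-zero p-prime e (a p) r aₚ≢0 uᵣ≡0
  ... | inj₁ refl , ∣a₂∣≡ = ∣a₂∣≢ (trans ∣a₂∣≡ (cong (2 ^ℕ_) (sym (m*n/n≡m (suc e) 2))))
  ... | inj₂ refl , ∣a₃∣≡ = ∣a₃∣≢ (trans ∣a₃∣≡ (cong (3 ^ℕ_) (sym (m*n/n≡m (suc e) 2))))
  m≢0 : m ≢ 0
  m≢0 refl = p∤m (divides 0 refl)
  aₘ≢0 : a m ≢ 0ℤ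
  -- If a(m) = 0, minimality gives n ≤ m while m divides n. So m = n, which is divisible by `p`,
  -- contrary to the choice of `m`.
  aₘ≢0 aₘ≡0 = p∤m (subst (p ℕ.∣_) (ℕ.≤-antisym n≤m m≤n) p∣n)
    where
    n≤m : n ℕ.≤ m
    n≤m = n-minimal m (ℕ.n≢0⇒n>0 m≢0 , aₘ≡0)
    m≤n : m ℕ.≤ n
    m≤n = ∣⇒≤ {{ℕ.>-nonZero n≥1}} (divides (p ^ℕ r) refl)
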